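{- Let $M=(E,\mathcal I)$ be a finite matroid with rank function $\rho$ and $|E|=n$, let $f\in\mathrm{Hom}_d(n)$, let $e\in E$, and let $s:E\to\Omega=\{1,\dots,n\}$ be a label of $M$. Then: (a) $T_f(\emptyset;x,y)=\widetilde f(\emptyset)$, where $\emptyset$ (as argument of $T_f$) is the empty matroid. (b) If $e$ is a loop, then $T_f(M(s);x,y)=T_f(M(s)\backslash e;x,y)+(y-1)\,\widetilde f(s(e))\circ T_f(M(s)\backslash e;x,y)$. (c) If $e$ is a coloop, then $T_f(M(s);x,y)=(x-1)\,T_f(M(s)/e;x,y)+\widetilde f(s(e))\circ T_f(M(s)/e;x,y)$. (d) If $e$ is neither a loop nor a coloop, then $T_f(M(s);x,y)=T_f(M(s)\backslash e;x,y)+\widetilde f(s(e))\circ T_f(M(s)/e;x,y)$.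
   Context: Let $\Omega=\{1,\dots,n\}$ and $\Omega_d=\{Z\subset\Omega:|Z|=d\}$. $\mathrm{Hom}_d(n)$ is the real vector space of formal sums $f=\sum_{Z\in\Omega_d}f(Z)Z$, identified with functions $f:\Omega_d\to\mathbb R$. For $X\subset\Omega$ put $\widetilde f(X)=\sum_{Z\in\Omega_d,\,Z\subset X}f(Z)$. A label of a matroid $M$ with ground set $E$, $|E|=n$, is a bijection $s:E\to\Omega$; $M(s)$ denotes $M$ with ground set indexed by $s$. The weighted Tutte polynomial is $$T_f(M(s);x,y)=\sum_{A\subset E}\widetilde f(s(A))(x-1)^{\rho(E)-\rho(A)}(y-1)^{|A|-\rho(A)}.$$ An element $e$ is a loop if $\rho(\{e\})=0$, and a coloop if it lies in every basis. $M\backslash e$ (deletion) and $M/e$ (contraction) are the usual matroids on $E\setminus\{e\}$. $M(s)\backslash e$ and $M(s)/e$ are labelled by the restriction of $s$ (an injective map into the same $\Omega$), and $T_f$ of such minors is given by the same formula with the same $f$, the ground set and rank function being those of the minor (this also applies to the empty matroid in (a)). Operator $\circ$: $\widetilde f(X)\circ\widetilde f(Y):=\widetilde f(X\cup Y)$, extended distributively over sums and scalar (polynomial) multiples. It acts on expressions regarded as formal linear combinations of the symbols $\widetilde f(Y)$, $Y\subset\Omega$; with $\widetilde f(s(e))=\widetilde f(\{s(e)\})$, the operation $\widetilde f(s(e))\circ$ replaces each symbol $\widetilde f(Y)$ by $\widetilde f(Y\cup\{s(e)\})$. -}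

module Defs where

open import Algebra.Bundles using (CommutativeRing)
open import Algebra.Morphism.Structures using (module RingMorphisms)
import Algebra.Properties.Semiring.Exp as Exp
open import Data.Empty using (⊥-elim)
open import Data.Fin.Base using (Fin; zero; suc)
import Data.Fin.Properties as Fin
open import Data.Fin.Subset renaming (_-_ to _∖_)
open import Data.Fin.Subset.Properties
open import Data.List.Base as List using (List; []; _∷_; _++_)
open import Data.List.Extrema.Nat using (max)
import Data.Maybe.Base as Maybe
open import Data.Nat.Base using (ℕ; suc; _∸_; _<_; s<s)
open import Data.Nat.Properties as ℕ using ()
open import Data.Product.Base using (Σ; ∃-syntax; _×_; _,_; proj₁; proj₂)
open import Data.Sum.Base using ([_,_]′)
open import Data.Vec.Base using ([]; _∷_; here; there; tabulate)
open import Function.Base using (_∘_)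
open import Level using (Level; 0ℓ; _⊔_) renaming (suc to lsuc)
open import Relation.Binary.PropositionalEquality
  using (_≡_; refl; sym; trans; cong; subst; subst₂)
open import Relation.Nullary using (Dec; yes; no; does)
open import Relation.Nullary.Decidable using (_×-dec_; dec⇒maybe)
open import Relation.Unary using (Pred; Decidable)

private
  variable
    c ℓ a ℓ′ : Level
    d m n : ℕ

-- Every subset of E, each listed exactly once.
powerset : Subset n → List (Subset n)
powerset []            = [] ∷ []
powerset (outside ∷ E) = List.map (outside ∷_) (powerset E)
powerset (inside  ∷ E) =
  List.map (outside ∷_) (powerset E) ++ List.map (inside ∷_) (powerset E)

------------------------------------------------------------------------
-- Matroids

-- The ground set is a subset of an ambient finite set Fin m, so that the
-- minors of a matroid live in the same ambient set. Independence is
-- decidable because the rank function has to be computed from it.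
record Matroid (m : ℕ) : Set₁ where
  field
    ground      : Subset m
    Independent : Pred (Subset m) 0ℓ
    indep?      : Decidable Independent
    indep⇒⊆     : ∀ {I} → Independent I → I ⊆ ground
    ⊥-indep     : Independent ⊥
    downward    : ∀ {I J} → I ⊆ J → Independent J → Independent I
    augment     : ∀ {I J} → Independent I → Independent J → ∣ I ∣ < ∣ J ∣ →
                  ∃[ x ] (x ∈ J × x ∉ I × Independent (I ∪ ⁅ x ⁆))

open Matroid

Element : Matroid m → Set
Element M = ∃[ x ] x ∈ ground M

rank : Matroid m → Subset m → ℕ
rank M A = max 0 (List.map ∣_∣ (List.filter (indep? M) (powerset A)))

IsBasis : Matroid m → Subset m → Set
IsBasis M B = Independent M B × (∀ J → Independent M J → B ⊆ J → J ≡ B)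

IsLoop : (M : Matroid m) → Element M → Set
IsLoop M (e , _) = rank M ⁅ e ⁆ ≡ 0

IsColoop : (M : Matroid m) → Element M → Set
IsColoop M (e , _) = ∀ B → IsBasis M B → e ∈ B

x∉p∖x : ∀ (p : Subset m) x → x ∉ p ∖ x
x∉p∖x (inside  ∷ p) zero    ()
x∉p∖x (outside ∷ p) zero    ()
x∉p∖x (_       ∷ p) (suc x) h = x∉p∖x p x (drop-there h)

∣p∪⁅x⁆∣ : ∀ {p : Subset m} {x} → x ∉ p → ∣ p ∪ ⁅ x ⁆ ∣ ≡ suc ∣ p ∣
∣p∪⁅x⁆∣ {p = inside  ∷ p} {zero}  x∉p = ⊥-elim (x∉p here)
∣p∪⁅x⁆∣ {p = outside ∷ p} {zero}  x∉p = cong (suc ∘ ∣_∣) (∪-identityʳ p)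
∣p∪⁅x⁆∣ {p = inside  ∷ p} {suc x} x∉p =
  cong suc (∣p∪⁅x⁆∣ {p = p} (x∉p ∘ there))
∣p∪⁅x⁆∣ {p = outside ∷ p} {suc x} x∉p =
  ∣p∪⁅x⁆∣ {p = p} (x∉p ∘ there)

p⊆q⇒p∪r⊆q∪r : ∀ {p q : Subset m} r → p ⊆ q → p ∪ r ⊆ q ∪ r
p⊆q⇒p∪r⊆q∪r {p = p} {q} r p⊆q =
  [ p⊆p∪q r ∘ p⊆q , q⊆p∪q q r ]′ ∘ x∈p∪q⁻ p r

swap-∪ : ∀ (p q r : Subset m) → (p ∪ q) ∪ r ≡ (p ∪ r) ∪ q
swap-∪ p q r = trans (∪-assoc p q r)
  (trans (cong (p ∪_) (∪-comm q r)) (sym (∪-assoc p r q)))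

emptyMatroid : ∀ m → Matroid m
emptyMatroid m = record
  { ground      = ⊥
  ; Independent = _⊆ ⊥
  ; indep?      = _⊆? ⊥
  ; indep⇒⊆     = λ I⊆⊥ → I⊆⊥
  ; ⊥-indep     = λ x∈⊥ → x∈⊥
  ; downward    = λ I⊆J J⊆⊥ x∈I → J⊆⊥ (I⊆J x∈I)
  ; augment     = λ {I} {J} _ J⊆⊥ ∣I∣<∣J∣ → ⊥-elim (ℕ.n≮0
      (subst (∣ I ∣ <_) (trans (cong ∣_∣ (⊆-antisym J⊆⊥ (⊆-min J))) (∣⊥∣≡0 m)) ∣I∣<∣J∣))
  }

delete : (M : Matroid m) → Element M → Matroid m
delete M (e , _) = record
  { ground      = ground M ∖ e
  ; Independent = λ I → I ⊆ ground M ∖ e × Independent M I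
  ; indep?      = λ I → (I ⊆? (ground M ∖ e)) ×-dec indep? M I
  ; indep⇒⊆     = proj₁
  ; ⊥-indep     = ⊆-min _ , ⊥-indep M
  ; downward    = λ I⊆J (J⊆E , indJ) → ⊆-trans I⊆J J⊆E , downward M I⊆J indJ
  ; augment     = λ {I} (I⊆E , indI) (J⊆E , indJ) I<J →
      let x , x∈J , x∉I , ind = augment M indI indJ I<J in
      x , x∈J , x∉I ,
      (λ y∈ → [ I⊆E , (λ y∈x → subst (_∈ _) (sym (x∈⁅y⁆⇒x≡y x y∈x)) (J⊆E x∈J)) ]′
                (x∈p∪q⁻ I ⁅ x ⁆ y∈)) ,
      ind
  }

-- A maximal independent subset of {e}.
basisOf : Matroid m → Fin m → Subset m
basisOf M e with indep? M ⁅ e ⁆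
... | yes _ = ⁅ e ⁆
... | no  _ = ⊥

basisOf-indep : ∀ (M : Matroid m) e → Independent M (basisOf M e)
basisOf-indep M e with indep? M ⁅ e ⁆
... | yes ind = ind
... | no  _   = ⊥-indep M

∣p∪basisOf∣-mono : ∀ (M : Matroid m) e {p q} → e ∉ p → e ∉ q → ∣ p ∣ < ∣ q ∣ →
                   ∣ p ∪ basisOf M e ∣ < ∣ q ∪ basisOf M e ∣
∣p∪basisOf∣-mono M e {p} {q} e∉p e∉q p<q with indep? M ⁅ e ⁆
... | yes _ = subst₂ _<_ (sym (∣p∪⁅x⁆∣ {p = p} e∉p)) (sym (∣p∪⁅x⁆∣ {p = q} e∉q)) (s<s p<q)
... | no  _ = subst₂ _<_ (cong ∣_∣ (sym (∪-identityʳ p))) (cong ∣_∣ (sym (∪-identityʳ q))) p<q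

-- For a loop e this agrees with deletion.
contract : (M : Matroid m) → Element M → Matroid m
contract M (e , _) = record
  { ground      = ground M ∖ e
  ; Independent = λ I → I ⊆ ground M ∖ e × Independent M (I ∪ B)
  ; indep?      = λ I → (I ⊆? (ground M ∖ e)) ×-dec indep? M (I ∪ B)
  ; indep⇒⊆     = proj₁
  ; ⊥-indep     = ⊆-min _ ,
                  subst (Independent M) (sym (∪-identityˡ B)) (basisOf-indep M e)
  ; downward    = λ I⊆J (J⊆E , indJ) →
      ⊆-trans I⊆J J⊆E , downward M (p⊆q⇒p∪r⊆q∪r B I⊆J) indJ
  ; augment     = λ {I} {J} (I⊆E , indI) (J⊆E , indJ) I<J →
      let x , x∈J∪B , x∉I∪B , ind = augment M indI indJ
            (∣p∪basisOf∣-mono M e (x∉p∖x (ground M) e ∘ I⊆E)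
                                  (x∉p∖x (ground M) e ∘ J⊆E) I<J)
          x∈J = [ (λ h → h) , (λ x∈B → ⊥-elim (x∉I∪B (q⊆p∪q I B x∈B))) ]′
                (x∈p∪q⁻ J B x∈J∪B)
      in x , x∈J , x∉I∪B ∘ p⊆p∪q B ,
         (λ y∈ → [ I⊆E , (λ y∈x → subst (_∈ _) (sym (x∈⁅y⁆⇒x≡y x y∈x)) (J⊆E x∈J)) ]′
                   (x∈p∪q⁻ I ⁅ x ⁆ y∈)) ,
         subst (Independent M) (swap-∪ I B ⁅ x ⁆) ind
  }
  where B = basisOf M e

------------------------------------------------------------------------
-- Labels

-- A label of a matroid with n elements is a bijective labelling; the
-- induced labellings of its minors are only injective.
Labelling : Matroid m → ℕ → Set
Labelling M n = Element M → Fin n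

emptyLabelling : ∀ m n → Labelling (emptyMatroid m) n
emptyLabelling m n (_ , x∈⊥) = ⊥-elim (∉⊥ x∈⊥)

module _ (M : Matroid m) (e : Element M) (s : Labelling M n) where

  deleteLabelling : Labelling (delete M e) n
  deleteLabelling (x , x∈E∖e) = s (x , p─q⊆p (ground M) ⁅ proj₁ e ⁆ x∈E∖e)

  contractLabelling : Labelling (contract M e) n
  contractLabelling (x , x∈E∖e) = s (x , p─q⊆p (ground M) ⁅ proj₁ e ⁆ x∈E∖e)

∈-irrelevant : ∀ {p : Subset m} {x} (h₁ h₂ : x ∈ p) → h₁ ≡ h₂
∈-irrelevant here       here       = refl
∈-irrelevant (there h₁) (there h₂) = cong there (∈-irrelevant h₁ h₂)

Σ∈? : ∀ (p : Subset m) x {P : x ∈ p → Set} → (∀ h → Dec (P h)) → Dec (Σ (x ∈ p) P)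
Σ∈? p x P? with x ∈? p
... | no x∉p = no (x∉p ∘ proj₁)
... | yes h with P? h
...   | yes ph = yes (h , ph)
...   | no ¬ph = no λ (h′ , ph′) → ¬ph (subst _ (∈-irrelevant h′ h) ph′)

InImage : (M : Matroid m) → Labelling M n → Subset m → Fin n → Set
InImage M s A j = ∃[ x ] (x ∈ A × Σ (x ∈ ground M) λ x∈E → s (x , x∈E) ≡ j)

inImage? : ∀ (M : Matroid m) (s : Labelling M n) A j → Dec (InImage M s A j)
inImage? M s A j = Fin.any? λ x →
  (x ∈? A) ×-dec Σ∈? (ground M) x (λ x∈E → s (x , x∈E) Fin.≟ j)

-- s(A) = { j | s(x) = j for some x ∈ A }.
image : (M : Matroid m) → Labelling M n → Subset m → Subset n
image M s A = tabulate λ j → does (inImage? M s A j)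

------------------------------------------------------------------------
-- Hom_d(n)

Ω[_] : ℕ → ℕ → Set
Ω[ d ] n = Σ (Subset n) λ Z → ∣ Z ∣ ≡ d

Ω-list : ∀ d n → List (Ω[ d ] n)
Ω-list d n = List.mapMaybe
  (λ Z → Maybe.map (Z ,_) (dec⇒maybe (∣ Z ∣ ℕ.≟ d))) (powerset ⊤)

Hom : CommutativeRing c ℓ → ℕ → ℕ → Set c
Hom K d n = Ω[ d ] n → CommutativeRing.Carrier K

module _ (K : CommutativeRing c ℓ) where
  open CommutativeRing K

  -- f̃(X) is the sum of f(Z) over the d-subsets Z of X.
  tilde : Hom K d n → Subset n → Carrier
  tilde {d} {n} f X =
    List.foldr _+_ 0# (List.map f (List.filter (λ Z → proj₁ Z ⊆? X) (Ω-list d n)))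

------------------------------------------------------------------------
-- The weighted Tutte polynomial

-- With K the coefficients of f, taking the polynomial ring K[x,y] gives
-- polynomial identities, and taking K itself gives their evaluations.
record CommutativeAlgebra (K : CommutativeRing c ℓ) (a ℓ′ : Level) :
                          Set (c ⊔ ℓ ⊔ lsuc (a ⊔ ℓ′)) where
  field
    ring : CommutativeRing a ℓ′
  open RingMorphisms (CommutativeRing.rawRing K) (CommutativeRing.rawRing ring)
  field
    ι      : CommutativeRing.Carrier K → CommutativeRing.Carrier ring
    ι-homo : IsRingHomomorphism ι

module WeightedTutte {K : CommutativeRing c ℓ} (R : CommutativeAlgebra K a ℓ′) where
  open CommutativeAlgebra R
  open CommutativeRing ring using (Carrier; _+_; _*_; _-_; 0#; 1#)
  open Exp (CommutativeRing.semiring ring) using (_^_)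

  -- A formal linear combination of the symbols f̃(Y): a pair (c , Y)
  -- stands for the term c f̃(Y).
  Combination : ℕ → Set a
  Combination n = List (Carrier × Subset n)

  infixr 7 _⊚_

  -- X ⊚ L is f̃(X) ∘ L.
  _⊚_ : Subset n → Combination n → Combination n
  X ⊚ L = List.map (λ (c , Y) → c , X ∪ Y) L

  value : Hom K d n → Combination n → Carrier
  value f L = List.foldr _+_ 0# (List.map (λ (c , Y) → c * ι (tilde K f Y)) L)

  -- The truncated subtractions are exact, since rank M A is at most
  -- rank M (ground M) and ∣ A ∣ whenever A ⊆ ground M.
  coefficient : Matroid m → Carrier → Carrier → Subset m → Carrier
  coefficient M x y A =
    (x - 1#) ^ (rank M (ground M) ∸ rank M A) * (y - 1#) ^ (∣ A ∣ ∸ rank M A)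

  formalTutte : (M : Matroid m) → Labelling M n → Carrier → Carrier → Combination n
  formalTutte M s x y =
    List.map (λ A → coefficient M x y A , image M s A) (powerset (ground M))

  tutte : Hom K d n → (M : Matroid m) → Labelling M n → Carrier → Carrier → Carrier
  tutte f M s x y = value f (formalTutte M s x y)

module Submission where

-- Every subset of E is A or A ∪ {e} for a unique A ⊆ E∖e, so T_f(M) splits into
-- two sums over such A, with s(A ∪ {e}) = {s(e)} ∪ s(A). The terms are matched
-- through the ranks ρ(A) and ρ(A ∪ {e}): deletion keeps ρ(A); if e is independent
-- then ρ(A ∪ {e}) exceeds the rank of A in M/e by one; ρ(A ∪ {e}) = ρ(A) for a loop
-- and ρ(A) + 1 for a coloop; and ρ(E) = ρ(E∖e) when e is not a coloop, since some
-- basis then avoids e.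

open import Defs
open import Algebra.Bundles using (CommutativeRing)
import Algebra.Properties.CommutativeSemigroup as CommutativeSemigroupProperties
import Algebra.Properties.Semiring.Exp as Exp
open import Data.Fin.Base using (zero; suc)
open import Data.Fin.Properties using (_≟_)
open import Data.Fin.Subset
  using (Subset; inside; outside; ⊥; ⁅_⁆; ∣_∣; _∈_; _∉_; _⊆_; _∪_) renaming (_-_ to _∖_)
open import Data.Fin.Subset.Properties
open import Data.List.Base as List using (List; []; _∷_; _++_)
open import Data.List.Extrema.Nat using (argmax-sel; xs≤max)
import Data.List.Membership.Propositional as List
open import Data.List.Membership.Propositional.Properties
  using (∈-map⁺; ∈-map⁻; ∈-++⁺ˡ; ∈-++⁺ʳ; ∈-++⁻; ∈-filter⁺; ∈-filter⁻)
open import Data.List.Properties using (map-∘)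
import Data.List.Relation.Unary.All as All
open import Data.List.Relation.Unary.Any using (here; there)
open import Data.Nat.Base using (ℕ; zero; suc; _≤_; _∸_; s≤s)
import Data.Nat.Base as ℕ
import Data.Nat.Properties as ℕ
open import Data.Product.Base using (∃-syntax; _×_; _,_; proj₁; proj₂)
open import Data.Sum.Base using (inj₁; inj₂; [_,_]′)
open import Data.Vec.Base using ([]; _∷_; here; there)
open import Data.Vec.Properties using (lookup∘tabulate; []=⇒lookup; lookup⇒[]=)
open import Function.Base using (_∘_; id)
open import Function.Definitions using (Bijective)
open import Level using (Level)
open import Relation.Binary.PropositionalEquality
  using (_≡_; refl; sym; trans; cong; cong₂; subst)
import Relation.Binary.Reasoning.Setoid as SetoidReasoning
open import Relation.Nullary using (¬_; yes; no; contradiction)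
open import Relation.Nullary.Decidable using (decidable-stable; dec-true)

private
  variable
    c ℓ a ℓ′ : Level
    m n d : ℕ

-- Adding and removing one element of a subset.

x∈p⇒⁅x⁆⊆p : ∀ {p : Subset n} {x} → x ∈ p → ⁅ x ⁆ ⊆ p
x∈p⇒⁅x⁆⊆p {x = x} x∈p y∈x = subst (_∈ _) (sym (x∈⁅y⁆⇒x≡y x y∈x)) x∈p

p⊆r∧x∈r⇒p∪⁅x⁆⊆r : ∀ {p r : Subset n} {x} → p ⊆ r → x ∈ r → p ∪ ⁅ x ⁆ ⊆ r
p⊆r∧x∈r⇒p∪⁅x⁆⊆r {p = p} {x = x} p⊆r x∈r y∈ = [ p⊆r , x∈p⇒⁅x⁆⊆p x∈r ]′ (x∈p∪q⁻ p ⁅ x ⁆ y∈)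

p⊆[p∖x]∪⁅x⁆ : ∀ (p : Subset n) x → p ⊆ (p ∖ x) ∪ ⁅ x ⁆
p⊆[p∖x]∪⁅x⁆ p x {y} y∈p with y ≟ x
... | yes refl = q⊆p∪q (p ∖ x) ⁅ x ⁆ (x∈⁅x⁆ x)
... | no  y≢x  = p⊆p∪q ⁅ x ⁆ (x∈p∧x≢y⇒x∈p-y y∈p y≢x)

[p∖x]∪⁅x⁆≡p : ∀ {p : Subset n} {x} → x ∈ p → (p ∖ x) ∪ ⁅ x ⁆ ≡ p
[p∖x]∪⁅x⁆≡p {p = p} {x} x∈p =
  ⊆-antisym (p⊆r∧x∈r⇒p∪⁅x⁆⊆r (p─q⊆p p ⁅ x ⁆) x∈p) (p⊆[p∖x]∪⁅x⁆ p x)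

-- An inequality, so that `x ∈ p` and `x ∉ p` need no separate treatment.
∣p∣≤1+∣p∖x∣ : ∀ (p : Subset n) x → ∣ p ∣ ≤ suc ∣ p ∖ x ∣
∣p∣≤1+∣p∖x∣ p x = subst (∣ p ∣ ≤_) (∣p∪⁅x⁆∣ (x∉p∖x p x)) (p⊆q⇒∣p∣≤∣q∣ (p⊆[p∖x]∪⁅x⁆ p x))

p⊆q∪⁅x⁆∧x∉p⇒p⊆q : ∀ {p q : Subset n} {x} → p ⊆ q ∪ ⁅ x ⁆ → x ∉ p → p ⊆ q
p⊆q∪⁅x⁆∧x∉p⇒p⊆q {q = q} {x} p⊆ x∉p {y} y∈p =
  [ id , (λ y∈x → contradiction (subst (_∈ _) (x∈⁅y⁆⇒x≡y x y∈x) y∈p) x∉p) ]′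
    (x∈p∪q⁻ q ⁅ x ⁆ (p⊆ y∈p))

p⊆q∪⁅x⁆⇒p∖x⊆q : ∀ {p q : Subset n} {x} → p ⊆ q ∪ ⁅ x ⁆ → p ∖ x ⊆ q
p⊆q∪⁅x⁆⇒p∖x⊆q {p = p} {x = x} p⊆ =
  p⊆q∪⁅x⁆∧x∉p⇒p⊆q (⊆-trans (p─q⊆p p ⁅ x ⁆) p⊆) (x∉p∖x p x)

p⊆q∧x∉p⇒p⊆q∖x : ∀ {p q : Subset n} {x} → p ⊆ q → x ∉ p → p ⊆ q ∖ x
p⊆q∧x∉p⇒p⊆q∖x p⊆q x∉p y∈p =
  x∈p∧x≢y⇒x∈p-y (p⊆q y∈p) λ y≡x → x∉p (subst (_∈ _) y≡x y∈p)

-- Membership in the list of subsets.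

∈powerset⇒⊆ : ∀ (E : Subset n) {A} → A List.∈ powerset E → A ⊆ E
∈powerset⇒⊆ [] (here refl) = id
∈powerset⇒⊆ (outside ∷ E) A∈ with ∈-map⁻ (outside ∷_) A∈
... | B , B∈ , refl = out⊆ (∈powerset⇒⊆ E B∈)
∈powerset⇒⊆ (inside ∷ E) A∈ with ∈-++⁻ (List.map (outside ∷_) (powerset E)) A∈
... | inj₁ A∈ˡ with ∈-map⁻ (outside ∷_) A∈ˡ
...   | B , B∈ , refl = out⊆ (∈powerset⇒⊆ E B∈)
∈powerset⇒⊆ (inside ∷ E) A∈ | inj₂ A∈ʳ with ∈-map⁻ (inside ∷_) A∈ʳ
...   | B , B∈ , refl = in⊆in (∈powerset⇒⊆ E B∈)

⊆⇒∈powerset : ∀ (E : Subset n) {A} → A ⊆ E → A List.∈ powerset E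
⊆⇒∈powerset [] {[]} A⊆E = here refl
⊆⇒∈powerset (outside ∷ E) {outside ∷ A} A⊆E =
  ∈-map⁺ (outside ∷_) (⊆⇒∈powerset E (drop-∷-⊆ A⊆E))
⊆⇒∈powerset (outside ∷ E) {inside ∷ A} A⊆E = contradiction (A⊆E here) λ ()
⊆⇒∈powerset (inside ∷ E) {outside ∷ A} A⊆E =
  ∈-++⁺ˡ (∈-map⁺ (outside ∷_) (⊆⇒∈powerset E (drop-∷-⊆ A⊆E)))
⊆⇒∈powerset (inside ∷ E) {inside ∷ A} A⊆E =
  ∈-++⁺ʳ _ (∈-map⁺ (inside ∷_) (⊆⇒∈powerset E (drop-∷-⊆ A⊆E)))

powerset-⊥ : ∀ n → powerset (⊥ {n}) ≡ ⊥ ∷ []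
powerset-⊥ zero    = refl
powerset-⊥ (suc n) = cong (List.map (outside ∷_)) (powerset-⊥ n)

-- Rank

module _ (M : Matroid m) where
  open Matroid M

  private
    indepSizes : Subset m → List ℕ
    indepSizes A = List.map ∣_∣ (List.filter indep? (powerset A))

  indep⇒∣I∣≤rank : ∀ A {I} → I ⊆ A → Independent I → ∣ I ∣ ≤ rank M A
  indep⇒∣I∣≤rank A I⊆A indI = All.lookup (xs≤max 0 (indepSizes A))
    (∈-map⁺ ∣_∣ (∈-filter⁺ indep? (⊆⇒∈powerset A I⊆A) indI))

  maxIndep : ∀ A → ∃[ I ] (I ⊆ A × Independent I × ∣ I ∣ ≡ rank M A)
  maxIndep A with argmax-sel id 0 (indepSizes A)
  -- The maximum has default value 0, which need not come from the list; the empty set attains it.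
  ... | inj₁ rank≡0 = ⊥ , ⊆-min A , ⊥-indep , trans (∣⊥∣≡0 m) (sym rank≡0)
  ... | inj₂ rank∈  with ∈-map⁻ ∣_∣ rank∈
  ...   | I , I∈ , rank≡∣I∣ with ∈-filter⁻ indep? {xs = powerset A} I∈
  ...     | I∈powerset , indI = I , ∈powerset⇒⊆ A I∈powerset , indI , sym rank≡∣I∣

  -- With `indep⇒∣I∣≤rank` this makes the rank the least upper bound of the sizes of independent
  -- subsets, the form in which it is used below.
  rank-least : ∀ A {k} → (∀ {I} → I ⊆ A → Independent I → ∣ I ∣ ≤ k) → rank M A ≤ k
  rank-least A bound with maxIndep A
  ... | I , I⊆A , indI , ∣I∣≡rank = subst (_≤ _) ∣I∣≡rank (bound I⊆A indI)

  rank≤∣A∣ : ∀ A → rank M A ≤ ∣ A ∣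
  rank≤∣A∣ A = rank-least A λ I⊆A _ → p⊆q⇒∣p∣≤∣q∣ I⊆A

  rank-mono : ∀ {A B} → A ⊆ B → rank M A ≤ rank M B
  rank-mono {A} {B} A⊆B = rank-least A λ I⊆A → indep⇒∣I∣≤rank B (⊆-trans I⊆A A⊆B)

  -- Augmentation is repeated with elements of `J` until the size of `J` is reached.
  extendIndep : ∀ {I J} → Independent I → Independent J →
                ∃[ K ] (I ⊆ K × K ⊆ I ∪ J × Independent K × ∣ J ∣ ≤ ∣ K ∣)
  -- The first argument of `go` bounds how far `∣ I ∣` falls short of `∣ J ∣`; each augmentation
  -- lowers it by one, and `∣ J ∣` is a sufficient start.
  extendIndep {J = J} indI indJ = go ∣ J ∣ indI (ℕ.m≤m+n ∣ J ∣ _)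
    where
    go : ∀ k {I} → Independent I → ∣ J ∣ ≤ k ℕ.+ ∣ I ∣ →
         ∃[ K ] (I ⊆ K × K ⊆ I ∪ J × Independent K × ∣ J ∣ ≤ ∣ K ∣)
    go zero    {I} indI J≤I = I , id , p⊆p∪q J , indI , J≤I
    go (suc k) {I} indI J≤ with ∣ J ∣ ℕ.≤? ∣ I ∣
    ... | yes J≤I = I , id , p⊆p∪q J , indI , J≤I
    ... | no  J≰I with augment indI indJ (ℕ.≰⇒> J≰I)
    ...   | x , x∈J , x∉I , indIx
            with go k indIx (subst (∣ J ∣ ≤_)
                   (trans (sym (ℕ.+-suc k ∣ I ∣)) (cong (k ℕ.+_) (sym (∣p∪⁅x⁆∣ x∉I)))) J≤)
    ...     | K , Ix⊆K , K⊆ , indK , J≤K =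
              K , ⊆-trans (p⊆p∪q ⁅ x ⁆) Ix⊆K ,
              ⊆-trans K⊆ Ix∪J⊆I∪J , indK , J≤K
      where
      Ix∪J⊆I∪J : (I ∪ ⁅ x ⁆) ∪ J ⊆ I ∪ J
      Ix∪J⊆I∪J y∈ = [ p⊆r∧x∈r⇒p∪⁅x⁆⊆r (p⊆p∪q J) (q⊆p∪q I J x∈J) , q⊆p∪q I J ]′
                      (x∈p∪q⁻ (I ∪ ⁅ x ⁆) J y∈)

  -- An independent set containing `B` and one more element would be larger than the rank.
  indep-rank⇒basis : ∀ {B} → Independent B → rank M ground ≤ ∣ B ∣ → IsBasis M B
  indep-rank⇒basis {B} indB r≤B = indB , λ J indJ B⊆J → ⊆-antisym (J⊆B indJ B⊆J) B⊆J
    where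
    J⊆B : ∀ {J} → Independent J → B ⊆ J → J ⊆ B
    J⊆B {J} indJ B⊆J {x} x∈J = decidable-stable (x ∈? B) λ x∉B →
      ℕ.<-irrefl refl (ℕ.≤-trans
        (subst (_≤ ∣ J ∣) (∣p∪⁅x⁆∣ x∉B) (p⊆q⇒∣p∣≤∣q∣ (p⊆r∧x∈r⇒p∪⁅x⁆⊆r B⊆J x∈J)))
        (ℕ.≤-trans (indep⇒∣I∣≤rank ground (indep⇒⊆ indJ) indJ) r≤B))

  extendToBasis : ∀ {I} → Independent I → ∃[ B ] (I ⊆ B × IsBasis M B)
  extendToBasis indI with maxIndep ground
  ... | J , _ , indJ , ∣J∣≡rank with extendIndep indI indJ
  ...   | B , I⊆B , _ , indB , J≤B =
          B , I⊆B , indep-rank⇒basis indB (subst (_≤ ∣ B ∣) ∣J∣≡rank J≤B)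

  -- A basis is only assumed maximal for inclusion. Extending `B` from any independent `I` gives a
  -- superset of size at least `∣ I ∣`, which by maximality is `B` itself.
  rank≤∣basis∣ : ∀ {B} → IsBasis M B → rank M ground ≤ ∣ B ∣
  rank≤∣basis∣ {B} (indB , maximal) = rank-least ground λ {I} _ indI →
    let K , B⊆K , _ , indK , I≤K = extendIndep indB indI
    in subst (λ K → ∣ I ∣ ≤ ∣ K ∣) (maximal K indK B⊆K) I≤K

-- Deletion and contraction

module _ (M : Matroid m) (e : Element M) where
  open Matroid M

  private
    x   = proj₁ e
    E∖e = ground ∖ x

  groundSplit : E∖e ∪ ⁅ x ⁆ ≡ ground
  groundSplit = [p∖x]∪⁅x⁆≡p (proj₂ e)

  A⊆E∖e⇒e∉A : ∀ {A} → A ⊆ E∖e → x ∉ A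
  A⊆E∖e⇒e∉A A⊆ = x∉p∖x ground x ∘ A⊆

  rank-delete : ∀ {A} → A ⊆ E∖e → rank (delete M e) A ≡ rank M A
  rank-delete {A} A⊆ = ℕ.≤-antisym
    (rank-least (delete M e) A λ I⊆A indI → indep⇒∣I∣≤rank M A I⊆A (proj₂ indI))
    (rank-least M A λ I⊆A indI →
       indep⇒∣I∣≤rank (delete M e) A I⊆A (⊆-trans I⊆A A⊆ , indI))

  -- No independent set contains a loop, since `⁅ x ⁆` would then be independent of size 1 but rank
  -- 0. So independent subsets of `A ∪ ⁅ x ⁆` lie in `A`.
  loop⇒rank-∪ : IsLoop M e → ∀ A → rank M (A ∪ ⁅ x ⁆) ≡ rank M A
  loop⇒rank-∪ isLoop A = ℕ.≤-antisym
    (rank-least M (A ∪ ⁅ x ⁆) λ I⊆ indI → indep⇒∣I∣≤rank M A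
      (p⊆q∪⁅x⁆∧x∉p⇒p⊆q I⊆ λ x∈I → ¬indep (downward (x∈p⇒⁅x⁆⊆p x∈I) indI)) indI)
    (rank-mono M {A} (p⊆p∪q ⁅ x ⁆))
    where
    ¬indep : ¬ Independent ⁅ x ⁆
    ¬indep ind with subst (∣ ⁅ x ⁆ ∣ ≤_) isLoop (indep⇒∣I∣≤rank M ⁅ x ⁆ id ind)
    ... | 1≤0 rewrite ∣⁅x⁆∣≡1 x = contradiction 1≤0 λ ()

  -- If `⁅ x ⁆` were dependent, its only independent subset would be empty. Decidable independence
  -- removes the double negation.
  nonLoop⇒indep : ¬ IsLoop M e → Independent ⁅ x ⁆
  nonLoop⇒indep ¬loop = decidable-stable (indep? ⁅ x ⁆) λ ¬ind →
    ¬loop (ℕ.n≤0⇒n≡0 (rank-least M ⁅ x ⁆ λ {I} I⊆x indI →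
      subst (∣ I ∣ ≤_) (∣⊥∣≡0 m) (p⊆q⇒∣p∣≤∣q∣
        (p⊆q∪⁅x⁆∧x∉p⇒p⊆q (⊆-trans I⊆x (q⊆p∪q ⊥ ⁅ x ⁆))
          λ x∈I → ¬ind (downward (x∈p⇒⁅x⁆⊆p x∈I) indI)))))

  coloop⇒indep : IsColoop M e → Independent ⁅ x ⁆
  coloop⇒indep isColoop =
    let B , _ , isBasis = extendToBasis M ⊥-indep
    in downward (x∈p⇒⁅x⁆⊆p (isColoop B isBasis)) (proj₁ isBasis)

  -- Removing `x` from an independent set costs at most one element. Conversely, a largest
  -- independent `I ⊆ A` extends to a basis, which contains the coloop, so `I ∪ ⁅ x ⁆` is
  -- independent.
  coloop⇒rank-∪ : IsColoop M e → ∀ {A} → A ⊆ E∖e → rank M (A ∪ ⁅ x ⁆) ≡ suc (rank M A)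
  coloop⇒rank-∪ isColoop {A} A⊆ = ℕ.≤-antisym
    (rank-least M (A ∪ ⁅ x ⁆) λ {I} I⊆ indI → ℕ.≤-trans (∣p∣≤1+∣p∖x∣ I x)
      (s≤s (indep⇒∣I∣≤rank M A (p⊆q∪⁅x⁆⇒p∖x⊆q I⊆) (downward (p─q⊆p I ⁅ x ⁆) indI))))
    1+rank≤
    where
    1+rank≤ : suc (rank M A) ≤ rank M (A ∪ ⁅ x ⁆)
    1+rank≤ =
      let I , I⊆A , indI , ∣I∣≡rank = maxIndep M A
          B , I⊆B , isBasis         = extendToBasis M indI
          indIx = downward (p⊆r∧x∈r⇒p∪⁅x⁆⊆r I⊆B (isColoop B isBasis)) (proj₁ isBasis)
      in subst (_≤ rank M (A ∪ ⁅ x ⁆))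
           (trans (∣p∪⁅x⁆∣ (A⊆E∖e⇒e∉A (⊆-trans I⊆A A⊆))) (cong suc ∣I∣≡rank))
           (indep⇒∣I∣≤rank M (A ∪ ⁅ x ⁆) (p⊆q⇒p∪r⊆q∪r ⁅ x ⁆ I⊆A) indIx)

  -- Not being a coloop yields no basis avoiding e constructively; equality of
  -- ranks is decidable, so it suffices to refute rank M E∖e ≢ rank M ground.
  nonColoop⇒rank : ¬ IsColoop M e → rank M E∖e ≡ rank M ground
  nonColoop⇒rank ¬coloop = decidable-stable (rank M E∖e ℕ.≟ rank M ground) λ rank≢ →
    ¬coloop λ B isBasis → decidable-stable (x ∈? B) λ x∉B →
      rank≢ (ℕ.≤-antisym (rank-mono M (p─q⊆p ground ⁅ x ⁆))
        (ℕ.≤-trans (rank≤∣basis∣ M isBasis)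
          (indep⇒∣I∣≤rank M E∖e (p⊆q∧x∉p⇒p⊆q∖x (indep⇒⊆ (proj₁ isBasis)) x∉B) (proj₁ isBasis))))

  indep⇒basisOf : Independent ⁅ x ⁆ → basisOf M x ≡ ⁅ x ⁆
  indep⇒basisOf ind with indep? ⁅ x ⁆
  ... | yes _   = refl
  ... | no ¬ind = contradiction ind ¬ind

  rank-contract : Independent ⁅ x ⁆ → ∀ {A} → A ⊆ E∖e →
                  rank M (A ∪ ⁅ x ⁆) ≡ suc (rank (contract M e) A)
  rank-contract ind {A} A⊆ = ℕ.≤-antisym (rank-least M (A ∪ ⁅ x ⁆) bound) 1+rank≤
    where
    basis≡ = indep⇒basisOf ind

    bound : ∀ {J} → J ⊆ A ∪ ⁅ x ⁆ → Independent J → ∣ J ∣ ≤ suc (rank (contract M e) A)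
    bound {J} J⊆ indJ =
      -- `J` may miss `x`. Extending `⁅ x ⁆` from `J` gives a set `K` that contains `x`, stays
      -- inside `A ∪ ⁅ x ⁆` and is no smaller; removing `x` from it leaves an independent set of the
      -- contraction.
      let K , x⊆K , K⊆ , indK , J≤K = extendIndep M ind indJ
          K⊆A∪x : K ⊆ A ∪ ⁅ x ⁆
          K⊆A∪x = λ y∈K → [ q⊆p∪q A ⁅ x ⁆ , J⊆ ]′ (x∈p∪q⁻ ⁅ x ⁆ J (K⊆ y∈K))
          K∖x⊆A = p⊆q∪⁅x⁆⇒p∖x⊆q K⊆A∪x
          indK∖x = subst Independent
            (sym (trans (cong ((K ∖ x) ∪_) basis≡) ([p∖x]∪⁅x⁆≡p (x⊆K (x∈⁅x⁆ x))))) indK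
      in ℕ.≤-trans J≤K (ℕ.≤-trans (∣p∣≤1+∣p∖x∣ K x)
           (s≤s (indep⇒∣I∣≤rank (contract M e) A K∖x⊆A (⊆-trans K∖x⊆A A⊆ , indK∖x))))

    1+rank≤ : suc (rank (contract M e) A) ≤ rank M (A ∪ ⁅ x ⁆)
    1+rank≤ =
      let I , I⊆A , indI , ∣I∣≡rank = maxIndep (contract M e) A
      in subst (_≤ rank M (A ∪ ⁅ x ⁆))
           (trans (∣p∪⁅x⁆∣ (A⊆E∖e⇒e∉A (proj₁ indI))) (cong suc ∣I∣≡rank))
           (indep⇒∣I∣≤rank M (A ∪ ⁅ x ⁆) (p⊆q⇒p∪r⊆q∪r ⁅ x ⁆ I⊆A)
             (subst (λ B → Independent (I ∪ B)) basis≡ (proj₂ indI)))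

  rank-ground-contract : Independent ⁅ x ⁆ → rank M ground ≡ suc (rank (contract M e) E∖e)
  rank-ground-contract ind =
    trans (cong (rank M) (sym groundSplit)) (rank-contract ind id)

-- Images under labellings

∈image⁺ : ∀ (M : Matroid m) (s : Labelling M n) {A j} → InImage M s A j → j ∈ image M s A
∈image⁺ M s {A} {j} h = lookup⇒[]= j _ (trans (lookup∘tabulate _ j) (dec-true (inImage? M s A j) h))

∈image⁻ : ∀ (M : Matroid m) (s : Labelling M n) {A j} → j ∈ image M s A → InImage M s A j
∈image⁻ M s {A} {j} j∈ with inImage? M s A j | trans (sym (lookup∘tabulate _ j)) ([]=⇒lookup j∈)
... | yes h | _  = h
... | no  _ | ()

image-⊥ : ∀ (M : Matroid m) (s : Labelling M n) → image M s ⊥ ≡ ⊥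
image-⊥ M s = ⊆-antisym (λ j∈ → contradiction (proj₁ (proj₂ (∈image⁻ M s j∈))) ∉⊥) (⊆-min _)

module _ (M : Matroid m) (e : Element M) (s : Labelling M n) where
  open Matroid M

  private
    x  = proj₁ e
    s′ = deleteLabelling M e s

  -- Elements carry membership proofs, and `deleteLabelling` builds its own; `∈-irrelevant`
  -- reconciles it with the given one.
  image-delete : ∀ {A} → A ⊆ ground ∖ x → image M s A ≡ image (delete M e) s′ A
  image-delete {A} A⊆ = ⊆-antisym
    (λ j∈ → let y , y∈A , y∈E , sy≡j = ∈image⁻ M s j∈ in
      ∈image⁺ (delete M e) s′ (y , y∈A , A⊆ y∈A ,
        trans (cong (λ h → s (y , h)) (∈-irrelevant _ y∈E)) sy≡j))
    (λ j∈ → let y , y∈A , _ , sy≡j = ∈image⁻ (delete M e) s′ j∈ in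
      ∈image⁺ M s (y , y∈A , _ , sy≡j))

  -- `⁅ s e ⁆` stands on the left to match the union formed by `_⊚_`.
  image-∪⁅e⁆ : ∀ A → image M s (A ∪ ⁅ x ⁆) ≡ ⁅ s e ⁆ ∪ image M s A
  image-∪⁅e⁆ A = ⊆-antisym ⊆∪ ∪⊆
    where
    ⊆∪ : image M s (A ∪ ⁅ x ⁆) ⊆ ⁅ s e ⁆ ∪ image M s A
    ⊆∪ {j} j∈ with ∈image⁻ M s j∈
    ... | y , y∈ , y∈E , sy≡j with x∈p∪q⁻ A ⁅ x ⁆ y∈
    ...   | inj₁ y∈A = q⊆p∪q ⁅ s e ⁆ _ (∈image⁺ M s (y , y∈A , y∈E , sy≡j))
    ...   | inj₂ y∈x with x∈⁅y⁆⇒x≡y x y∈x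
    ...     | refl = p⊆p∪q _ (subst (_∈ ⁅ s e ⁆)
                       (trans (cong (λ h → s (x , h)) (∈-irrelevant (proj₂ e) y∈E)) sy≡j)
                       (x∈⁅x⁆ (s e)))

    ∪⊆ : ⁅ s e ⁆ ∪ image M s A ⊆ image M s (A ∪ ⁅ x ⁆)
    ∪⊆ j∈ with x∈p∪q⁻ ⁅ s e ⁆ (image M s A) j∈
    ... | inj₁ j∈se = ∈image⁺ M s
            (x , q⊆p∪q A ⁅ x ⁆ (x∈⁅x⁆ x) , proj₂ e , sym (x∈⁅y⁆⇒x≡y (s e) j∈se))
    ... | inj₂ j∈sA =
            let y , y∈A , y∈E , sy≡j = ∈image⁻ M s j∈sA
            in ∈image⁺ M s (y , p⊆p∪q ⁅ x ⁆ y∈A , y∈E , sy≡j)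

-- Sums over powersets

module Sums (R : CommutativeRing a ℓ) where
  open CommutativeRing R hiding (sym; trans; refl; zero)
  private module R = CommutativeRing R
  open CommutativeSemigroupProperties +-commutativeSemigroup using (interchange)
  open SetoidReasoning setoid

  sum : {B : Set c} → (B → Carrier) → List B → Carrier
  sum g xs = List.foldr _+_ 0# (List.map g xs)

  sum-map : ∀ {B : Set c} {C : Set ℓ′} (g : C → Carrier) (h : B → C) xs →
            sum g (List.map h xs) ≡ sum (g ∘ h) xs
  sum-map g h xs = cong (List.foldr _+_ 0#) (sym (map-∘ xs))

  sum-++ : ∀ {B : Set c} (g : B → Carrier) xs ys → sum g (xs ++ ys) ≈ sum g xs + sum g ys
  sum-++ g []       ys = R.sym (+-identityˡ _)
  sum-++ g (x ∷ xs) ys = R.trans (+-congˡ (sum-++ g xs ys)) (R.sym (+-assoc _ _ _))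

  -- Agreement on members of the list suffices, so identities valid only for subsets avoiding e can
  -- be used.
  sum-cong : ∀ {B : Set c} {g h : B → Carrier} xs → (∀ {x} → x List.∈ xs → g x ≈ h x) →
             sum g xs ≈ sum h xs
  sum-cong []       g≈h = R.refl
  sum-cong (x ∷ xs) g≈h = +-cong (g≈h (here refl)) (sum-cong xs (g≈h ∘ there))

  *-distribˡ-sum : ∀ {B : Set c} k (g : B → Carrier) xs → k * sum g xs ≈ sum (λ x → k * g x) xs
  *-distribˡ-sum k g []       = zeroʳ k
  *-distribˡ-sum k g (x ∷ xs) = R.trans (distribˡ k _ _) (+-congˡ (*-distribˡ-sum k g xs))

  -- Serves to pull the extra factor `x - 1#` or `y - 1#` out of a sum.
  sum-*-assoc : ∀ {B : Set c} k (g h : B → Carrier) xs →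
                sum (λ b → (k * g b) * h b) xs ≈ k * sum (λ b → g b * h b) xs
  sum-*-assoc k g h xs = R.trans (sum-cong xs λ _ → *-assoc k _ _)
                                 (R.sym (*-distribˡ-sum k _ xs))

  sum-powerset-outside : ∀ (g : Subset (suc n) → Carrier) E →
    sum g (powerset (outside ∷ E)) ≡ sum (g ∘ (outside ∷_)) (powerset E)
  sum-powerset-outside g E = sum-map g (outside ∷_) (powerset E)

  sum-powerset-inside : ∀ (g : Subset (suc n) → Carrier) E →
    sum g (powerset (inside ∷ E)) ≈
    sum (g ∘ (outside ∷_)) (powerset E) + sum (g ∘ (inside ∷_)) (powerset E)
  sum-powerset-inside g E = R.trans
    (sum-++ g (List.map (outside ∷_) (powerset E)) (List.map (inside ∷_) (powerset E)))
    (reflexive (cong₂ _+_ (sum-powerset-outside g E)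
                          (sum-map g (inside ∷_) (powerset E))))

  -- Subsets are sorted by whether they contain `x`, by induction along `powerset` to the position
  -- of `x`.
  sum-powerset-split : ∀ (g : Subset n → Carrier) {E x} → x ∈ E →
    sum g (powerset E) ≈
    sum g (powerset (E ∖ x)) + sum (λ A → g (A ∪ ⁅ x ⁆)) (powerset (E ∖ x))
  sum-powerset-split g {inside ∷ E} {zero} here =
    -- Removing `zero` leaves `E` minus `⊥` as the tail, equal to `E` only propositionally.
    subst (λ F → sum g (powerset (inside ∷ E)) ≈
                 sum g (powerset F) + sum (λ A → g (A ∪ ⁅ zero ⁆)) (powerset F))
      (cong (outside ∷_) (sym (p─⊥≡p E)))
      (R.trans (sum-powerset-inside g E) (+-cong
        (reflexive (sym (sum-powerset-outside g E)))
        (R.trans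
          (sum-cong (powerset E) λ {A} _ → reflexive (cong (g ∘ (inside ∷_)) (sym (∪-identityʳ A))))
          (reflexive (sym (sum-powerset-outside (λ A → g (A ∪ ⁅ zero ⁆)) E))))))
  sum-powerset-split g {outside ∷ E} {suc x} (there x∈E) = R.trans
    (reflexive (sum-powerset-outside g E))
    (R.trans (sum-powerset-split (g ∘ (outside ∷_)) x∈E)
      (reflexive (sym (cong₂ _+_ (sum-powerset-outside g (E ∖ x))
                                 (sum-powerset-outside (λ A → g (A ∪ ⁅ suc x ⁆)) (E ∖ x))))))
  sum-powerset-split g {inside ∷ E} {suc x} (there x∈E) = begin
    sum g (powerset (inside ∷ E))
      ≈⟨ sum-powerset-inside g E ⟩
    sum gₒ (powerset E) + sum gᵢ (powerset E)
      ≈⟨ +-cong (sum-powerset-split gₒ x∈E) (sum-powerset-split gᵢ x∈E) ⟩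
    (sum gₒ E∖x + sum (λ A → gₒ (A ∪ ⁅ x ⁆)) E∖x) + (sum gᵢ E∖x + sum (λ A → gᵢ (A ∪ ⁅ x ⁆)) E∖x)
      -- Grouping by the head element becomes grouping by `x`.
      ≈⟨ interchange _ _ _ _ ⟩
    (sum gₒ E∖x + sum gᵢ E∖x) + (sum (λ A → gₒ (A ∪ ⁅ x ⁆)) E∖x + sum (λ A → gᵢ (A ∪ ⁅ x ⁆)) E∖x)
      ≈⟨ +-cong (sum-powerset-inside g (E ∖ x))
                (sum-powerset-inside (λ A → g (A ∪ ⁅ suc x ⁆)) (E ∖ x)) ⟨
    sum g (powerset (inside ∷ (E ∖ x))) +
    sum (λ A → g (A ∪ ⁅ suc x ⁆)) (powerset (inside ∷ (E ∖ x)))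
      ∎
    where
    gₒ  = g ∘ (outside ∷_)
    gᵢ  = g ∘ (inside ∷_)
    E∖x = powerset (E ∖ x)

-- Deletion-contraction

module _ {K : CommutativeRing c ℓ} (R : CommutativeAlgebra K a ℓ′) where
  open CommutativeAlgebra R
  open CommutativeRing ring hiding (sym; trans; refl; zero; ring)
  open WeightedTutte R
  open Exp semiring using (_^_)
  private module R = CommutativeRing ring
  open CommutativeSemigroupProperties *-commutativeSemigroup using (x∙yz≈y∙xz)
  open Sums ring
  open SetoidReasoning setoid

  private
    weight : Carrier → Carrier → ℕ → ℕ → Carrier
    weight x y k l = (x - 1#) ^ k * (y - 1#) ^ l

  module _ (f : Hom K d n) where

    value-map : ∀ {B : Set} (k : B → Carrier) (Y : B → Subset n) xs →
                value f (List.map (λ b → k b , Y b) xs) ≡ sum (λ b → k b * ι (tilde K f (Y b))) xs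
    value-map k Y = sum-map _ _

    value-⊚ : ∀ {B : Set} (k : B → Carrier) (Y : B → Subset n) Z xs →
              value f (Z ⊚ List.map (λ b → k b , Y b) xs) ≡
              sum (λ b → k b * ι (tilde K f (Z ∪ Y b))) xs
    value-⊚ k Y Z xs = trans (cong (value f) (sym (map-∘ xs))) (value-map k _ xs)

    tutte-empty : ∀ m x y → tutte f (emptyMatroid m) (emptyLabelling m n) x y ≈ ι (tilde K f ⊥)
    tutte-empty m x y = begin
      tutte f ∅ s x y
        ≡⟨ cong (λ As → value f (List.map (λ A → coefficient ∅ x y A , image ∅ s A) As)) (powerset-⊥ m) ⟩
      coefficient ∅ x y ⊥ * ι (tilde K f (image ∅ s ⊥)) + 0#
        ≈⟨ +-identityʳ _ ⟩
      coefficient ∅ x y ⊥ * ι (tilde K f (image ∅ s ⊥))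
        ≡⟨ cong₂ (λ u Y → u * ι (tilde K f Y)) coefficient≡ (image-⊥ ∅ s) ⟩
      (1# * 1#) * ι (tilde K f ⊥)
        ≈⟨ *-congʳ (*-identityˡ 1#) ⟩
      1# * ι (tilde K f ⊥)
        ≈⟨ *-identityˡ _ ⟩
      ι (tilde K f ⊥)
        ∎
      where
      ∅ = emptyMatroid m
      s = emptyLabelling m n

      -- The rank r need not be computed: the exponents are r ∸ r and 0 ∸ r.
      coefficient≡ : coefficient ∅ x y ⊥ ≡ 1# * 1#
      coefficient≡ = cong₂ (weight x y) (ℕ.n∸n≡0 (rank ∅ ⊥))
        (trans (cong (_∸ rank ∅ ⊥) (∣⊥∣≡0 m)) (ℕ.0∸n≡0 (rank ∅ ⊥)))

    module _ (M : Matroid m) (e : Element M) (s : Labelling M n) (x y : Carrier) where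
      open Matroid M

      private
        E∖e = ground ∖ proj₁ e

        -- The contraction has the same ground set and labelling, so this is
        -- also its image map, definitionally.
        sA : Subset m → Subset n
        sA = image (delete M e) (deleteLabelling M e s)

      -- Common to the three cases: the first sum comes from subsets avoiding e, the second from
      -- those containing it, and each case only has to identify the coefficients.
      tutte-split : (c₁ c₂ : Subset m → Carrier) →
        (∀ {A} → A ⊆ E∖e → coefficient M x y A ≈ c₁ A) →
        (∀ {A} → A ⊆ E∖e → coefficient M x y (A ∪ ⁅ proj₁ e ⁆) ≈ c₂ A) →
        tutte f M s x y ≈
        sum (λ A → c₁ A * ι (tilde K f (sA A))) (powerset E∖e) +
        sum (λ A → c₂ A * ι (tilde K f (⁅ s e ⁆ ∪ sA A))) (powerset E∖e)
      tutte-split c₁ c₂ c₁≈ c₂≈ = begin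
        tutte f M s x y
          ≡⟨ value-map (coefficient M x y) (image M s) (powerset ground) ⟩
        sum term (powerset ground)
          ≈⟨ sum-powerset-split term (proj₂ e) ⟩
        sum term (powerset E∖e) + sum (λ A → term (A ∪ ⁅ proj₁ e ⁆)) (powerset E∖e)
          ≈⟨ +-cong
               (sum-cong (powerset E∖e) λ A∈ → let A⊆ = ∈powerset⇒⊆ E∖e A∈ in
                 *-cong (c₁≈ A⊆) (reflexive (cong (ι ∘ tilde K f) (image-delete M e s A⊆))))
               (sum-cong (powerset E∖e) λ {A} A∈ → let A⊆ = ∈powerset⇒⊆ E∖e A∈ in
                 *-cong (c₂≈ A⊆) (reflexive (cong (ι ∘ tilde K f)
                   (trans (image-∪⁅e⁆ M e s A) (cong (⁅ s e ⁆ ∪_) (image-delete M e s A⊆)))))) ⟩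
        _ ∎
        where
        term : Subset m → Carrier
        term A = coefficient M x y A * ι (tilde K f (image M s A))

      -- Adding a loop to `A` raises the cardinality but not the rank, whence one more factor
      -- `y - 1#`.
      tutte-loop : IsLoop M e →
        tutte f M s x y ≈
        tutte f (delete M e) (deleteLabelling M e s) x y
          + (y - 1#) * value f (⁅ s e ⁆ ⊚ formalTutte (delete M e) (deleteLabelling M e s) x y)
      tutte-loop isLoop = begin
        tutte f M s x y
          ≈⟨ tutte-split c′ (λ A → (y - 1#) * c′ A) c≈ c∪≈ ⟩
        sum (λ A → c′ A * ι (tilde K f (sA A))) (powerset E∖e) +
        sum (λ A → ((y - 1#) * c′ A) * ι (tilde K f (⁅ s e ⁆ ∪ sA A))) (powerset E∖e)
          ≈⟨ +-congˡ (sum-*-assoc (y - 1#) c′ _ (powerset E∖e)) ⟩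
        _ + (y - 1#) * sum (λ A → c′ A * ι (tilde K f (⁅ s e ⁆ ∪ sA A))) (powerset E∖e)
          ≡⟨ cong₂ (λ u v → u + (y - 1#) * v) (value-map c′ sA (powerset E∖e))
                                              (value-⊚ c′ sA ⁅ s e ⁆ (powerset E∖e)) ⟨
        _ ∎
        where
        c′ = coefficient (delete M e) x y

        rankE : rank M ground ≡ rank (delete M e) E∖e
        rankE = trans (cong (rank M) (sym (groundSplit M e)))
                      (trans (loop⇒rank-∪ M e isLoop E∖e) (sym (rank-delete M e id)))

        c≈ : ∀ {A} → A ⊆ E∖e → coefficient M x y A ≈ c′ A
        c≈ {A} A⊆ = reflexive (cong₂ (λ r r′ → weight x y (r ∸ r′) (∣ A ∣ ∸ r′))
          rankE (sym (rank-delete M e A⊆)))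

        c∪≈ : ∀ {A} → A ⊆ E∖e → coefficient M x y (A ∪ ⁅ proj₁ e ⁆) ≈ (y - 1#) * c′ A
        c∪≈ {A} A⊆ = R.trans
          (reflexive (cong₂ (weight x y)
            (cong₂ _∸_ rankE rankA∪)
            (trans (cong₂ _∸_ (∣p∪⁅x⁆∣ (A⊆E∖e⇒e∉A M e A⊆)) rankA∪)
                   -- The successor leaves the truncated difference because the rank of `A` is at
                   -- most `∣ A ∣`.
                   (ℕ.+-∸-assoc 1 (rank≤∣A∣ (delete M e) A)))))
          (x∙yz≈y∙xz _ _ _)
          where
          rankA∪ : rank M (A ∪ ⁅ proj₁ e ⁆) ≡ rank (delete M e) A
          rankA∪ = trans (loop⇒rank-∪ M e isLoop A) (sym (rank-delete M e A⊆))

      -- The two ranks and the cardinality all exceed their counterparts in the contraction by one,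
      -- so the successors cancel in both exponents.
      coefficient-contract : Independent ⁅ proj₁ e ⁆ → ∀ {A} → A ⊆ E∖e →
        coefficient M x y (A ∪ ⁅ proj₁ e ⁆) ≡ coefficient (contract M e) x y A
      coefficient-contract ind {A} A⊆ = cong₂ (weight x y)
        (cong₂ _∸_ (rank-ground-contract M e ind) (rank-contract M e ind A⊆))
        (cong₂ _∸_ (∣p∪⁅x⁆∣ (A⊆E∖e⇒e∉A M e A⊆)) (rank-contract M e ind A⊆))

      -- For `A` avoiding e, contraction keeps the rank of `A` and lowers that of the ground set by
      -- one, whence the factor `x - 1#`.
      tutte-coloop : IsColoop M e →
        tutte f M s x y ≈
        (x - 1#) * tutte f (contract M e) (contractLabelling M e s) x y
          + value f (⁅ s e ⁆ ⊚ formalTutte (contract M e) (contractLabelling M e s) x y)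
      tutte-coloop isColoop = begin
        tutte f M s x y
          ≈⟨ tutte-split (λ A → (x - 1#) * c′ A) c′ c≈
               (λ A⊆ → reflexive (coefficient-contract ind A⊆)) ⟩
        sum (λ A → ((x - 1#) * c′ A) * ι (tilde K f (sA A))) (powerset E∖e) +
        sum (λ A → c′ A * ι (tilde K f (⁅ s e ⁆ ∪ sA A))) (powerset E∖e)
          ≈⟨ +-congʳ (sum-*-assoc (x - 1#) c′ _ (powerset E∖e)) ⟩
        (x - 1#) * sum (λ A → c′ A * ι (tilde K f (sA A))) (powerset E∖e) + _
          ≡⟨ cong₂ (λ u v → (x - 1#) * u + v) (value-map c′ sA (powerset E∖e))
                                              (value-⊚ c′ sA ⁅ s e ⁆ (powerset E∖e)) ⟨
        _ ∎
        where
        c′  = coefficient (contract M e) x y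
        ind = coloop⇒indep M e isColoop

        rankA : ∀ {A} → A ⊆ E∖e → rank M A ≡ rank (contract M e) A
        -- Both ranks are one below that of `A` with e added.
        rankA A⊆ = ℕ.suc-injective
          (trans (sym (coloop⇒rank-∪ M e isColoop A⊆)) (rank-contract M e ind A⊆))

        c≈ : ∀ {A} → A ⊆ E∖e → coefficient M x y A ≈ (x - 1#) * c′ A
        c≈ {A} A⊆ = R.trans
          (reflexive (cong₂ (weight x y)
            (trans (cong₂ _∸_ (rank-ground-contract M e ind) (rankA A⊆))
                   -- Monotonicity of the rank makes the truncated difference exact.
                   (ℕ.+-∸-assoc 1 (rank-mono (contract M e) {A} A⊆)))
            (cong (∣ A ∣ ∸_) (rankA A⊆))))
          (*-assoc _ _ _)

      -- As e is not a coloop, deletion keeps the rank of the ground set, which settles the subsets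
      -- avoiding e. As e is not a loop, it is independent, and the subsets containing e match the
      -- contraction.
      tutte-neither : ¬ IsLoop M e → ¬ IsColoop M e →
        tutte f M s x y ≈
        tutte f (delete M e) (deleteLabelling M e s) x y
          + value f (⁅ s e ⁆ ⊚ formalTutte (contract M e) (contractLabelling M e s) x y)
      tutte-neither ¬loop ¬coloop = begin
        tutte f M s x y
          ≈⟨ tutte-split (coefficient (delete M e) x y) (coefficient (contract M e) x y) c≈
               (λ A⊆ → reflexive (coefficient-contract (nonLoop⇒indep M e ¬loop) A⊆)) ⟩
        _ ≡⟨ cong₂ _+_ (value-map (coefficient (delete M e) x y) sA (powerset E∖e))
                       (value-⊚ (coefficient (contract M e) x y) sA ⁅ s e ⁆ (powerset E∖e)) ⟨
        _ ∎
        where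
        rankE : rank M ground ≡ rank (delete M e) E∖e
        rankE = trans (sym (nonColoop⇒rank M e ¬coloop)) (sym (rank-delete M e id))

        c≈ : ∀ {A} → A ⊆ E∖e → coefficient M x y A ≈ coefficient (delete M e) x y A
        c≈ {A} A⊆ = reflexive (cong₂ (λ r r′ → weight x y (r ∸ r′) (∣ A ∣ ∸ r′))
          rankE (sym (rank-delete M e A⊆)))

proposition4p1 : {c ℓ a ℓ′ : Level} (K : CommutativeRing c ℓ) (R : CommutativeAlgebra K a ℓ′) →
  let open CommutativeAlgebra R
      open CommutativeRing ring
      open WeightedTutte R
  in
  (m n d : ℕ) (M : Matroid m) → ∣ Matroid.ground M ∣ ≡ n →
  (f : Hom K d n) (e : Element M) (s : Labelling M n) → Bijective _≡_ _≡_ s →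
  (x y : Carrier) →
    (tutte f (emptyMatroid m) (emptyLabelling m n) x y ≈ ι (tilde K f ⊥))
  × (IsLoop M e →
       tutte f M s x y
         ≈ tutte f (delete M e) (deleteLabelling M e s) x y
           + (y - 1#) * value f (⁅ s e ⁆ ⊚ formalTutte (delete M e) (deleteLabelling M e s) x y))
  × (IsColoop M e →
       tutte f M s x y
         ≈ (x - 1#) * tutte f (contract M e) (contractLabelling M e s) x y
           + value f (⁅ s e ⁆ ⊚ formalTutte (contract M e) (contractLabelling M e s) x y))
  × (¬ IsLoop M e → ¬ IsColoop M e →
       tutte f M s x y
         ≈ tutte f (delete M e) (deleteLabelling M e s) x y
           + value f (⁅ s e ⁆ ⊚ formalTutte (contract M e) (contractLabelling M e s) x y))
proposition4p1 K R m n d M _ f e s _ x y =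
    tutte-empty R f m x y
  , tutte-loop R f M e s x y
  , tutte-coloop R f M e s x y
  , tutte-neither R f M e s x y
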